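{- Let $(\mathcal{B},\mathbb{C},F,\mathbb{H})$ be a pre-geminal category, with associated endofunctor $\Box=\gamma_{\mathbb C}\circ F:\mathcal B\to\mathcal B$. For any object $A\in\mathcal{B}$ and any morphism $f:\Box A\to A$ in $\mathcal B$, there exists a global element $a:1\to A$ such that $f\circ Fa=a$, where $Fa:1\to\mathbb C(F1,FA)=\mathbb C(1_{\mathbb C},FA)=\Box A$ is the global element of $\Box A$ given by applying $F$ to $a$.
   Context: Internal categories. Let $\mathcal B$ be a locally small category with finite limits (a terminal object $1$ and pullbacks). A $\mathcal B$-internal category $\mathbb C$ has an object of objects $|\mathbb C|$, an object of morphisms $|\mathbb C^{\to}|$, morphisms $\mathrm{dom},\mathrm{cod}:|\mathbb C^\to|\to|\mathbb C|$, identities $e:|\mathbb C|\to|\mathbb C^\to|$ and a composition $\circ$ defined on the object of composable pairs (written in diagrammatic order), satisfying the usual axioms. An internal functor $\mathbb H:\mathbb C\to\mathbb D$ is a pair $|\mathbb H|:|\mathbb C|\to|\mathbb D|$, $|\mathbb H^\to|:|\mathbb C^\to|\to|\mathbb D^\to|$ commuting with this structure. A global element of $A$, written $a\in_1 A$, is a morphism $a:1\to A$. A global object $X\in_1\mathbb C$ is a morphism $X:1\to|\mathbb C|$; $\mathbb HX=|\mathbb H|\circ X$. The hom-object $\mathbb C(X,Y)$ is the pullback of $\langle\mathrm{dom},\mathrm{cod}\rangle:|\mathbb C^\to|\to|\mathbb C|\times|\mathbb C|$ along $\langle X,Y\rangle:1\to|\mathbb C|\times|\mathbb C|$; its global elements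 are identified with global elements of $|\mathbb C^\to|$ with domain $X$ and codomain $Y$. Composition induces $\circ_{\mathbb C}:\mathbb C(X,Y)\times\mathbb C(Y,Z)\to\mathbb C(X,Z)$. The underlying category $\Gamma\mathbb C$ has global objects as objects and global elements of $\mathbb C(X,Y)$ as morphisms $X\to Y$; an internal functor $\mathbb H$ induces a functor $\Gamma\mathbb H$. $\mathbb C$ has chosen finite limits if it is equipped with an internal chosen terminal object $1_{\mathbb C}\in_1\mathbb C$ and internal chosen pullbacks (given by morphisms of $\mathcal B$ expressing a choice of pullback squares and of mediating arrows, satisfying the evident internal equations); then $\Gamma\mathbb C$ has induced chosen finite limits. The global section functor is $\gamma_{\mathbb C}=\mathbb C(1_{\mathbb C},-):\Gamma\mathbb C\to\mathcal B$ (acting on morphisms by $\circ_{\mathbb C}$); it preserves finite limits. If $G:\mathcal B\to\mathcal B'$ preserves finite limits, $G\mathbb C$ is the $\mathcal B'$-internal category obtained by applying $G$ to all data of $\mathbb C$, and $G^{\#}_{\mathbb C}:\Gamma\mathbb C\to\Gamma G\mathbb C$ is the functor sending a global object $X$ to $1\cong G1\xrightarrow{GX}G|\mathbb C|$, and likewise on global morphisms. Pre-geminal category. It consists of: (I) a category $\mathcal B$ with chosen finite limits; (II) a $\mathcal B$-internal category $\mathbb C$ with chosen finite limits; (III) a functor $F:\mathcal B\to\Gamma\mathbb C$ strictly preserving the chosen finite limits; put $\Box=\gamma_{\mathbb C}\circ F:\mathcal B\to\mathcal B$, so $\Box A=\mathbb C(1_{\mathbb C},FA)$ (it preserves finite limits);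 (IV) a $\mathcal B$-internal functor $\mathbb H:\mathbb C\to\Box\mathbb C$ satisfying $\Gamma\mathbb H\circ F=F^{\#}_{\mathbb C}\circ F$, where the codomain $\Gamma F\mathbb C$ of $F^\#_{\mathbb C}$ is identified with $\Gamma\Box\mathbb C=\Gamma\gamma_{\mathbb C}F\mathbb C$ by the canonical isomorphism. Unfolded: with $u:1\cong\Box1$ the unique isomorphism, $|\mathbb H|\circ FA=\Box(FA)\circ u:1\to\Box|\mathbb C|$ for every object $A$ of $\mathcal B$, and $|\mathbb H^\to|\circ Ff=\Box(Ff)\circ u:1\to\Box|\mathbb C^\to|$ for every morphism $f$ of $\mathcal B$, where $FA:1\to|\mathbb C|$ and $Ff:1\to|\mathbb C^\to|$. -}

module Defs where

open import Level using (Level; _⊔_; suc)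
open import Relation.Binary using (Setoid; IsEquivalence)
import Relation.Binary.Reasoning.Setoid as SetoidReasoning

private
  variable
    o ℓ e o′ ℓ′ e′ o″ ℓ″ e″ : Level

-- Hom-sets are setoids and there is no equality of objects.

record Category (o ℓ e : Level) : Set (suc (o ⊔ ℓ ⊔ e)) where
  infix  4 _≈_ _⇒_
  infixr 9 _∘_
  field
    Obj   : Set o
    _⇒_   : Obj → Obj → Set ℓ
    _≈_   : ∀ {A B} → A ⇒ B → A ⇒ B → Set e
    id    : ∀ {A} → A ⇒ A
    _∘_   : ∀ {A B C} → B ⇒ C → A ⇒ B → A ⇒ C
    equiv : ∀ {A B} → IsEquivalence (_≈_ {A} {B})
    ∘-cong : ∀ {A B C} {f f′ : B ⇒ C} {g g′ : A ⇒ B} →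
             f ≈ f′ → g ≈ g′ → f ∘ g ≈ f′ ∘ g′
    identityˡ : ∀ {A B} {f : A ⇒ B} → id ∘ f ≈ f
    identityʳ : ∀ {A B} {f : A ⇒ B} → f ∘ id ≈ f
    assoc : ∀ {A B C D} {f : A ⇒ B} {g : B ⇒ C} {h : C ⇒ D} →
            (h ∘ g) ∘ f ≈ h ∘ (g ∘ f)

  module Equiv {A B : Obj} = IsEquivalence (equiv {A} {B})
  open Equiv public

  homSetoid : Obj → Obj → Setoid ℓ e
  homSetoid A B = record { Carrier = A ⇒ B ; _≈_ = _≈_ ; isEquivalence = equiv }

  module ≈-Reasoning {A B : Obj} = SetoidReasoning (homSetoid A B)

  ∘-congˡ : ∀ {A B C} {f f′ : B ⇒ C} {g : A ⇒ B} → f ≈ f′ → f ∘ g ≈ f′ ∘ g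
  ∘-congˡ p = ∘-cong p refl

  ∘-congʳ : ∀ {A B C} {f : B ⇒ C} {g g′ : A ⇒ B} → g ≈ g′ → f ∘ g ≈ f ∘ g′
  ∘-congʳ p = ∘-cong refl p

  pullˡ : ∀ {A B C D} {f : C ⇒ D} {g : B ⇒ C} {k : B ⇒ D} {h : A ⇒ B} →
          f ∘ g ≈ k → f ∘ (g ∘ h) ≈ k ∘ h
  pullˡ p = trans (sym assoc) (∘-congˡ p)

  glue : ∀ {A B C B′ D} {f : C ⇒ D} {g : B ⇒ C} {f′ : B′ ⇒ D} {g′ : B ⇒ B′} {h : A ⇒ B} →
         f ∘ g ≈ f′ ∘ g′ → f ∘ (g ∘ h) ≈ f′ ∘ (g′ ∘ h)
  glue p = trans (pullˡ p) assoc

record Functor (𝓐 : Category o ℓ e) (𝓑 : Category o′ ℓ′ e′) :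
       Set (o ⊔ ℓ ⊔ e ⊔ o′ ⊔ ℓ′ ⊔ e′) where
  private
    module A = Category 𝓐
    module B = Category 𝓑
  field
    F₀ : A.Obj → B.Obj
    F₁ : ∀ {X Y} → X A.⇒ Y → F₀ X B.⇒ F₀ Y
    F-cong : ∀ {X Y} {f g : X A.⇒ Y} → f A.≈ g → F₁ f B.≈ F₁ g
    F-id : ∀ {X} → F₁ (A.id {X}) B.≈ B.id
    F-∘  : ∀ {X Y Z} {f : X A.⇒ Y} {g : Y A.⇒ Z} → F₁ (g A.∘ f) B.≈ F₁ g B.∘ F₁ f

  F-square : ∀ {W X Y Z} {f : W A.⇒ X} {g : X A.⇒ Z} {h : W A.⇒ Y} {k : Y A.⇒ Z} →
             g A.∘ f A.≈ k A.∘ h → F₁ g B.∘ F₁ f B.≈ F₁ k B.∘ F₁ h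
  F-square p = B.trans (B.sym F-∘) (B.trans (F-cong p) F-∘)

  F-triangle : ∀ {X Y Z} {f : X A.⇒ Y} {g : Y A.⇒ Z} {h : X A.⇒ Z} →
               g A.∘ f A.≈ h → F₁ g B.∘ F₁ f B.≈ F₁ h
  F-triangle p = B.trans (B.sym F-∘) (F-cong p)

infixr 9 _∘F_

_∘F_ : {𝓐 : Category o ℓ e} {𝓑 : Category o′ ℓ′ e′} {𝓒 : Category o″ ℓ″ e″} →
       Functor 𝓑 𝓒 → Functor 𝓐 𝓑 → Functor 𝓐 𝓒
_∘F_ {𝓒 = 𝓒} G F = record
  { F₀ = λ X → G.F₀ (F.F₀ X)
  ; F₁ = λ f → G.F₁ (F.F₁ f)
  ; F-cong = λ p → G.F-cong (F.F-cong p)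
  ; F-id = trans (G.F-cong F.F-id) G.F-id
  ; F-∘ = trans (G.F-cong F.F-∘) G.F-∘
  }
  where
    module F = Functor F
    module G = Functor G
    open Category 𝓒 using (trans)

module _ (𝓑 : Category o ℓ e) where
  open Category 𝓑

  record IsTerminal (⊤ : Obj) : Set (o ⊔ ℓ ⊔ e) where
    field
      !        : ∀ {A} → A ⇒ ⊤
      !-unique : ∀ {A} (f g : A ⇒ ⊤) → f ≈ g

  record IsPullback {P A B C : Obj} (p₁ : P ⇒ A) (p₂ : P ⇒ B) (f : A ⇒ C) (g : B ⇒ C) :
         Set (o ⊔ ℓ ⊔ e) where
    field
      commute   : f ∘ p₁ ≈ g ∘ p₂
      universal : ∀ {T} (h : T ⇒ A) (k : T ⇒ B) → f ∘ h ≈ g ∘ k → T ⇒ P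
      p₁∘universal : ∀ {T} {h : T ⇒ A} {k : T ⇒ B} {s : f ∘ h ≈ g ∘ k} →
                     p₁ ∘ universal h k s ≈ h
      p₂∘universal : ∀ {T} {h : T ⇒ A} {k : T ⇒ B} {s : f ∘ h ≈ g ∘ k} →
                     p₂ ∘ universal h k s ≈ k
      unique    : ∀ {T} {x y : T ⇒ P} → p₁ ∘ x ≈ p₁ ∘ y → p₂ ∘ x ≈ p₂ ∘ y → x ≈ y

  record ChosenFiniteLimits : Set (o ⊔ ℓ ⊔ e) where
    field
      ⊤          : Obj
      isTerminal : IsTerminal ⊤
      Pb         : ∀ {A B C} (f : A ⇒ C) (g : B ⇒ C) → Obj
      pb₁        : ∀ {A B C} (f : A ⇒ C) (g : B ⇒ C) → Pb f g ⇒ A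
      pb₂        : ∀ {A B C} (f : A ⇒ C) (g : B ⇒ C) → Pb f g ⇒ B
      isPullback : ∀ {A B C} (f : A ⇒ C) (g : B ⇒ C) → IsPullback (pb₁ f g) (pb₂ f g) f g

    open IsTerminal isTerminal public

    module pb {A B C : Obj} (f : A ⇒ C) (g : B ⇒ C) = IsPullback (isPullback f g)

    infixr 7 _×_
    _×_ : Obj → Obj → Obj
    A × B = Pb (! {A}) (! {B})

    fst : ∀ {A B} → A × B ⇒ A
    fst = pb₁ ! !

    snd : ∀ {A B} → A × B ⇒ B
    snd = pb₂ ! !

    opaque
      ⟨_,_⟩ : ∀ {T A B} → T ⇒ A → T ⇒ B → T ⇒ A × B
      ⟨ h , k ⟩ = pb.universal ! ! h k (!-unique _ _)

      fst∘⟨⟩ : ∀ {T A B} {h : T ⇒ A} {k : T ⇒ B} → fst ∘ ⟨ h , k ⟩ ≈ h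
      fst∘⟨⟩ = pb.p₁∘universal ! !

      snd∘⟨⟩ : ∀ {T A B} {h : T ⇒ A} {k : T ⇒ B} → snd ∘ ⟨ h , k ⟩ ≈ k
      snd∘⟨⟩ = pb.p₂∘universal ! !

record PreservesFiniteLimits {𝓐 : Category o ℓ e} {𝓑 : Category o′ ℓ′ e′} (G : Functor 𝓐 𝓑) :
       Set (o ⊔ ℓ ⊔ e ⊔ o′ ⊔ ℓ′ ⊔ e′) where
  open Functor G
  open Category 𝓐
  field
    preserves-⊤  : ∀ {X} → IsTerminal 𝓐 X → IsTerminal 𝓑 (F₀ X)
    preserves-pb : ∀ {P A B C} {p₁ : P ⇒ A} {p₂ : P ⇒ B} {f : A ⇒ C} {g : B ⇒ C} →
                   IsPullback 𝓐 p₁ p₂ f g → IsPullback 𝓑 (F₁ p₁) (F₁ p₂) (F₁ f) (F₁ g)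

∘F-preserves : {𝓐 : Category o ℓ e} {𝓑 : Category o′ ℓ′ e′} {𝓒 : Category o″ ℓ″ e″}
               {G : Functor 𝓑 𝓒} {F : Functor 𝓐 𝓑} →
               PreservesFiniteLimits G → PreservesFiniteLimits F → PreservesFiniteLimits (G ∘F F)
∘F-preserves G F = record
  { preserves-⊤  = λ t → G.preserves-⊤ (F.preserves-⊤ t)
  ; preserves-pb = λ p → G.preserves-pb (F.preserves-pb p)
  }
  where
    module G = PreservesFiniteLimits G
    module F = PreservesFiniteLimits F

module _ {𝓐 : Category o ℓ e} {𝓑 : Category o′ ℓ′ e′} (L : ChosenFiniteLimits 𝓐)
         (G : Functor 𝓐 𝓑) where
  private
    module A = Category 𝓐
    module B = Category 𝓑
    module L = ChosenFiniteLimits L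
  open Functor G

  opaque
    preservesFromChosen :
      IsTerminal 𝓑 (F₀ L.⊤) →
      (∀ {A B C} (f : A A.⇒ C) (g : B A.⇒ C) →
         IsPullback 𝓑 (F₁ (L.pb₁ f g)) (F₁ (L.pb₂ f g)) (F₁ f) (F₁ g)) →
      PreservesFiniteLimits G
    preservesFromChosen G⊤ Gpb = record { preserves-⊤ = term ; preserves-pb = pull }
      where
        term : ∀ {X} → IsTerminal 𝓐 X → IsTerminal 𝓑 (F₀ X)
        term {X} t = record
          { ! = F₁ t.! B.∘ T.!
          ; !-unique = λ f g → B.trans (expand f)
              (B.trans (B.∘-congʳ (T.!-unique _ _)) (B.sym (expand g)))
          }
          where
            module t = IsTerminal t
            module T = IsTerminal G⊤
            retract : F₁ t.! B.∘ F₁ (L.! {X}) B.≈ B.id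
            retract = B.trans (F-triangle (t.!-unique _ A.id)) F-id
            expand : ∀ {A} (f : A B.⇒ F₀ X) → f B.≈ F₁ t.! B.∘ (F₁ L.! B.∘ f)
            expand f = B.sym (B.trans (B.pullˡ retract) B.identityˡ)

        pull : ∀ {P A B C} {p₁ : P A.⇒ A} {p₂ : P A.⇒ B} {f : A A.⇒ C} {g : B A.⇒ C} →
               IsPullback 𝓐 p₁ p₂ f g → IsPullback 𝓑 (F₁ p₁) (F₁ p₂) (F₁ f) (F₁ g)
        pull {P} {p₁ = p₁} {p₂} {f} {g} q = record
          { commute = F-square q.commute
          ; universal = λ h k s → F₁ back B.∘ Q.universal h k s
          ; p₁∘universal = B.trans (B.pullˡ (F-triangle q.p₁∘universal)) Q.p₁∘universal
          ; p₂∘universal = B.trans (B.pullˡ (F-triangle q.p₂∘universal)) Q.p₂∘universal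
          ; unique = λ {_} {x} {y} s t → B.trans (expand x) (B.trans (B.∘-congʳ (Q.unique
              (B.trans (B.pullˡ (F-triangle c.p₁∘universal))
                (B.trans s (B.sym (B.pullˡ (F-triangle c.p₁∘universal)))))
              (B.trans (B.pullˡ (F-triangle c.p₂∘universal))
                (B.trans t (B.sym (B.pullˡ (F-triangle c.p₂∘universal)))))))
              (B.sym (expand y)))
          }
          where
            module q = IsPullback q
            module c = L.pb f g
            module Q = IsPullback (Gpb f g)
            back : L.Pb f g A.⇒ P
            back = q.universal (L.pb₁ f g) (L.pb₂ f g) c.commute
            forth : P A.⇒ L.Pb f g
            forth = c.universal p₁ p₂ q.commute
            back∘forth : back A.∘ forth A.≈ A.id
            back∘forth = q.unique
              (A.trans (A.pullˡ q.p₁∘universal) (A.trans c.p₁∘universal (A.sym A.identityʳ)))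
              (A.trans (A.pullˡ q.p₂∘universal) (A.trans c.p₂∘universal (A.sym A.identityʳ)))
            expand : ∀ {T} (x : T B.⇒ F₀ P) → x B.≈ F₁ back B.∘ (F₁ forth B.∘ x)
            expand x = B.sym (B.trans (B.pullˡ (B.trans (F-triangle back∘forth) F-id)) B.identityˡ)

-- The object C₂ of composable pairs may be any pullback of cod along dom, so
-- that a finite-limit-preserving functor can be applied directly to all data.
-- Equations between composites are stated for generalized elements T ⇒ C₁.

record InternalCategory (𝓑 : Category o ℓ e) : Set (o ⊔ ℓ ⊔ e) where
  open Category 𝓑
  infix 8 _⨾_[_]
  field
    C₀ C₁ C₂   : Obj
    dom cod    : C₁ ⇒ C₀
    ide        : C₀ ⇒ C₁
    π₁ π₂      : C₂ ⇒ C₁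
    composable : IsPullback 𝓑 π₁ π₂ cod dom
    comp       : C₂ ⇒ C₁

  module C₂ = IsPullback composable

  _⨾_[_] : ∀ {T} (f g : T ⇒ C₁) → cod ∘ f ≈ dom ∘ g → T ⇒ C₁
  f ⨾ g [ p ] = comp ∘ C₂.universal f g p

  field
    dom-ide  : dom ∘ ide ≈ id
    cod-ide  : cod ∘ ide ≈ id
    dom-comp : dom ∘ comp ≈ dom ∘ π₁
    cod-comp : cod ∘ comp ≈ cod ∘ π₂
    ⨾-identityˡ : ∀ {T} {f : T ⇒ C₁} (p : cod ∘ (ide ∘ (dom ∘ f)) ≈ dom ∘ f) →
                  (ide ∘ (dom ∘ f)) ⨾ f [ p ] ≈ f
    ⨾-identityʳ : ∀ {T} {f : T ⇒ C₁} (p : cod ∘ f ≈ dom ∘ (ide ∘ (cod ∘ f))) →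
                  f ⨾ (ide ∘ (cod ∘ f)) [ p ] ≈ f
    ⨾-assoc : ∀ {T} {f g h : T ⇒ C₁}
              (p : cod ∘ f ≈ dom ∘ g) (q : cod ∘ g ≈ dom ∘ h)
              (p′ : cod ∘ (f ⨾ g [ p ]) ≈ dom ∘ h) (q′ : cod ∘ f ≈ dom ∘ (g ⨾ h [ q ])) →
              (f ⨾ g [ p ]) ⨾ h [ p′ ] ≈ f ⨾ (g ⨾ h [ q ]) [ q′ ]

  ⨾-cong : ∀ {T} {f f′ g g′ : T ⇒ C₁} {p : cod ∘ f ≈ dom ∘ g} {p′ : cod ∘ f′ ≈ dom ∘ g′} →
           f ≈ f′ → g ≈ g′ → f ⨾ g [ p ] ≈ f′ ⨾ g′ [ p′ ]
  ⨾-cong r s = ∘-congʳ (C₂.unique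
    (trans C₂.p₁∘universal (trans r (sym C₂.p₁∘universal)))
    (trans C₂.p₂∘universal (trans s (sym C₂.p₂∘universal))))

  ⨾-∘ : ∀ {S T} {f g : T ⇒ C₁} {p : cod ∘ f ≈ dom ∘ g} {t : S ⇒ T} {f′ g′ : S ⇒ C₁}
        {p′ : cod ∘ f′ ≈ dom ∘ g′} → f ∘ t ≈ f′ → g ∘ t ≈ g′ →
        (f ⨾ g [ p ]) ∘ t ≈ f′ ⨾ g′ [ p′ ]
  ⨾-∘ r s = trans assoc (∘-congʳ (C₂.unique
    (trans (pullˡ C₂.p₁∘universal) (trans r (sym C₂.p₁∘universal)))
    (trans (pullˡ C₂.p₂∘universal) (trans s (sym C₂.p₂∘universal)))))

  dom-⨾ : ∀ {T} {f g : T ⇒ C₁} {p : cod ∘ f ≈ dom ∘ g} → dom ∘ (f ⨾ g [ p ]) ≈ dom ∘ f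
  dom-⨾ = trans (glue dom-comp) (∘-congʳ C₂.p₁∘universal)

  cod-⨾ : ∀ {T} {f g : T ⇒ C₁} {p : cod ∘ f ≈ dom ∘ g} → cod ∘ (f ⨾ g [ p ]) ≈ cod ∘ g
  cod-⨾ = trans (glue cod-comp) (∘-congʳ C₂.p₂∘universal)

  ⨾-idˡ : ∀ {T} {i f : T ⇒ C₁} {p : cod ∘ i ≈ dom ∘ f} {x : T ⇒ C₀} →
          i ≈ ide ∘ x → i ⨾ f [ p ] ≈ f
  ⨾-idˡ {i = i} {f} {p} {x} r = trans (⨾-cong i≈ refl) (⨾-identityˡ cod-i)
    where
      cod-i : cod ∘ (ide ∘ (dom ∘ f)) ≈ dom ∘ f
      cod-i = trans (pullˡ cod-ide) identityˡ
      i≈ : i ≈ ide ∘ (dom ∘ f)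
      i≈ = trans r (∘-congʳ (trans (sym (trans (∘-congʳ r) (trans (pullˡ cod-ide) identityˡ))) p))

  ⨾-idʳ : ∀ {T} {i f : T ⇒ C₁} {p : cod ∘ f ≈ dom ∘ i} {x : T ⇒ C₀} →
          i ≈ ide ∘ x → f ⨾ i [ p ] ≈ f
  ⨾-idʳ {i = i} {f} {p} {x} r = trans (⨾-cong refl i≈) (⨾-identityʳ dom-i)
    where
      dom-i : cod ∘ f ≈ dom ∘ (ide ∘ (cod ∘ f))
      dom-i = sym (trans (pullˡ dom-ide) identityˡ)
      i≈ : i ≈ ide ∘ (cod ∘ f)
      i≈ = trans r (∘-congʳ (sym (trans p (trans (∘-congʳ r) (trans (pullˡ dom-ide) identityˡ)))))

record InternalFunctor {𝓑 : Category o ℓ e} (ℂ 𝔻 : InternalCategory 𝓑) : Set (ℓ ⊔ e) where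
  open Category 𝓑
  private
    module ℂ = InternalCategory ℂ
    module 𝔻 = InternalCategory 𝔻
  field
    H₀ : ℂ.C₀ ⇒ 𝔻.C₀
    H₁ : ℂ.C₁ ⇒ 𝔻.C₁
    H-dom : 𝔻.dom ∘ H₁ ≈ H₀ ∘ ℂ.dom
    H-cod : 𝔻.cod ∘ H₁ ≈ H₀ ∘ ℂ.cod
    H-ide : H₁ ∘ ℂ.ide ≈ 𝔻.ide ∘ H₀

  H-composable : 𝔻.cod ∘ (H₁ ∘ ℂ.π₁) ≈ 𝔻.dom ∘ (H₁ ∘ ℂ.π₂)
  H-composable = trans (glue H-cod) (trans (∘-congʳ ℂ.C₂.commute) (sym (glue H-dom)))

  field
    H-comp : H₁ ∘ ℂ.comp ≈ (H₁ ∘ ℂ.π₁) 𝔻.⨾ (H₁ ∘ ℂ.π₂) [ H-composable ]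

module _ {𝓐 : Category o ℓ e} {𝓑 : Category o′ ℓ′ e′} (L : ChosenFiniteLimits 𝓐)
         (G : Functor 𝓐 𝓑) (G-pres : PreservesFiniteLimits G) (ℂ : InternalCategory 𝓐) where
  private
    module A = Category 𝓐
    module L = ChosenFiniteLimits L
  open Category 𝓑
  open InternalCategory ℂ hiding (module C₂; _⨾_[_])
  open InternalCategory ℂ using () renaming (_⨾_[_] to _⨾ᶜ_[_])
  open Functor G
  open PreservesFiniteLimits G-pres

  private
    module K = IsPullback (InternalCategory.composable ℂ)
    module GK = IsPullback (preserves-pb composable)

    infix 8 _⨾′_[_]
    _⨾′_[_] : ∀ {T} (f g : T ⇒ F₀ C₁) → F₁ cod ∘ f ≈ F₁ dom ∘ g → T ⇒ F₀ C₁
    f ⨾′ g [ p ] = F₁ comp ∘ GK.universal f g p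

    image-⨾ : ∀ {S T} {f g : T A.⇒ C₁} {p : cod A.∘ f A.≈ dom A.∘ g} {t : S ⇒ F₀ T}
              {f′ g′ : S ⇒ F₀ C₁} {p′ : F₁ cod ∘ f′ ≈ F₁ dom ∘ g′} →
              F₁ f ∘ t ≈ f′ → F₁ g ∘ t ≈ g′ →
              f′ ⨾′ g′ [ p′ ] ≈ F₁ (f ⨾ᶜ g [ p ]) ∘ t
    image-⨾ r s = sym (trans (∘-congˡ F-∘) (trans assoc (∘-congʳ (GK.unique
      (trans (pullˡ (F-triangle K.p₁∘universal)) (trans r (sym GK.p₁∘universal)))
      (trans (pullˡ (F-triangle K.p₂∘universal)) (trans s (sym GK.p₂∘universal)))))))

    F-id∘ : ∀ {T X} {t : T ⇒ F₀ X} → F₁ A.id ∘ t ≈ t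
    F-id∘ = trans (∘-congˡ F-id) identityˡ

    idˡ : ∀ {T} {f : T ⇒ F₀ C₁} (p : F₁ cod ∘ (F₁ ide ∘ (F₁ dom ∘ f)) ≈ F₁ dom ∘ f) →
          (F₁ ide ∘ (F₁ dom ∘ f)) ⨾′ f [ p ] ≈ f
    idˡ p = trans
      (image-⨾ {f = ide A.∘ (dom A.∘ A.id)} {g = A.id}
        {p = A.trans (A.pullˡ cod-ide) A.identityˡ}
        (trans (∘-congˡ (trans F-∘ (∘-congʳ (F-cong A.identityʳ)))) assoc) F-id∘)
      (trans (∘-congˡ (F-cong (⨾-identityˡ _))) F-id∘)

    idʳ : ∀ {T} {f : T ⇒ F₀ C₁} (p : F₁ cod ∘ f ≈ F₁ dom ∘ (F₁ ide ∘ (F₁ cod ∘ f))) →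
          f ⨾′ (F₁ ide ∘ (F₁ cod ∘ f)) [ p ] ≈ f
    idʳ p = trans
      (image-⨾ {f = A.id} {g = ide A.∘ (cod A.∘ A.id)}
        {p = A.sym (A.trans (A.pullˡ dom-ide) A.identityˡ)}
        F-id∘ (trans (∘-congˡ (trans F-∘ (∘-congʳ (F-cong A.identityʳ)))) assoc))
      (trans (∘-congˡ (F-cong (⨾-identityʳ _))) F-id∘)

    assoc′ : ∀ {T} {f g h : T ⇒ F₀ C₁}
             (p : F₁ cod ∘ f ≈ F₁ dom ∘ g) (q : F₁ cod ∘ g ≈ F₁ dom ∘ h)
             (p′ : F₁ cod ∘ (f ⨾′ g [ p ]) ≈ F₁ dom ∘ h)
             (q′ : F₁ cod ∘ f ≈ F₁ dom ∘ (g ⨾′ h [ q ])) →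
             (f ⨾′ g [ p ]) ⨾′ h [ p′ ] ≈ f ⨾′ (g ⨾′ h [ q ]) [ q′ ]
    assoc′ {T} {f} {g} {h} p q p′ q′ =
      trans (image-⨾ {p = A.trans cod-⨾ q₀} (sym (image-⨾ f≈ g≈)) h≈)
        (trans (∘-congˡ (F-cong (⨾-assoc p₀ q₀ _ _)))
          (sym (image-⨾ {p = A.trans p₀ (A.sym dom-⨾)} f≈ (sym (image-⨾ g≈ h≈)))))
      where
        module C₃ = L.pb π₂ π₁
        module GC₃ = IsPullback (preserves-pb (L.isPullback π₂ π₁))
        l : L.Pb π₂ π₁ A.⇒ C₂
        l = L.pb₁ π₂ π₁
        r : L.Pb π₂ π₁ A.⇒ C₂
        r = L.pb₂ π₂ π₁
        f₀ g₀ h₀ : L.Pb π₂ π₁ A.⇒ C₁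
        f₀ = π₁ A.∘ l
        g₀ = π₂ A.∘ l
        h₀ = π₂ A.∘ r
        p₀ : cod A.∘ f₀ A.≈ dom A.∘ g₀
        p₀ = A.glue K.commute
        q₀ : cod A.∘ g₀ A.≈ dom A.∘ h₀
        q₀ = A.trans (A.∘-congʳ C₃.commute) (A.glue K.commute)
        t : T ⇒ F₀ (L.Pb π₂ π₁)
        t = GC₃.universal (GK.universal f g p) (GK.universal g h q)
              (trans GK.p₂∘universal (sym GK.p₁∘universal))
        f≈ : F₁ f₀ ∘ t ≈ f
        f≈ = trans (∘-congˡ F-∘) (trans assoc
               (trans (∘-congʳ GC₃.p₁∘universal) GK.p₁∘universal))
        g≈ : F₁ g₀ ∘ t ≈ g
        g≈ = trans (∘-congˡ F-∘) (trans assoc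
               (trans (∘-congʳ GC₃.p₁∘universal) GK.p₂∘universal))
        h≈ : F₁ h₀ ∘ t ≈ h
        h≈ = trans (∘-congˡ F-∘) (trans assoc
               (trans (∘-congʳ GC₃.p₂∘universal) GK.p₂∘universal))

  image : InternalCategory 𝓑
  image = record
    { C₀ = F₀ C₀ ; C₁ = F₀ C₁ ; C₂ = F₀ C₂
    ; dom = F₁ dom ; cod = F₁ cod ; ide = F₁ ide ; π₁ = F₁ π₁ ; π₂ = F₁ π₂
    ; composable = preserves-pb composable
    ; comp = F₁ comp
    ; dom-ide = trans (F-triangle dom-ide) F-id
    ; cod-ide = trans (F-triangle cod-ide) F-id
    ; dom-comp = F-square dom-comp
    ; cod-comp = F-square cod-comp
    ; ⨾-identityˡ = idˡ
    ; ⨾-identityʳ = idʳ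
    ; ⨾-assoc = assoc′
    }

module _ {𝓑 : Category o ℓ e} (L : ChosenFiniteLimits 𝓑) (ℂ : InternalCategory 𝓑) where
  open Category 𝓑
  open ChosenFiniteLimits L
  open InternalCategory ℂ

  record InternalChosenFiniteLimits : Set (o ⊔ ℓ ⊔ e) where
    field
      one         : ⊤ ⇒ C₀
      bang        : C₀ ⇒ C₁
      dom-bang    : dom ∘ bang ≈ id
      cod-bang    : cod ∘ bang ≈ one ∘ !
      bang-unique : ∀ {T} (m : T ⇒ C₁) → cod ∘ m ≈ one ∘ ! → m ≈ bang ∘ (dom ∘ m)

    Cospan : Obj
    Cospan = Pb cod cod

    -- The object of commutative squares h ⨾ f = k ⨾ g, that is, of pairs of
    -- composable pairs (h , f) and (k , g) with equal composites.
    Square : Obj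
    Square = Pb comp comp

    sq-h : Square ⇒ C₁
    sq-h = π₁ ∘ pb₁ comp comp

    sq-f : Square ⇒ C₁
    sq-f = π₂ ∘ pb₁ comp comp

    sq-k : Square ⇒ C₁
    sq-k = π₁ ∘ pb₂ comp comp

    sq-g : Square ⇒ C₁
    sq-g = π₂ ∘ pb₂ comp comp

    sq-cod : cod ∘ sq-f ≈ cod ∘ sq-g
    sq-cod = trans (sym (glue cod-comp)) (trans (∘-congʳ (pb.commute comp comp)) (glue cod-comp))

    sq-dom : dom ∘ sq-h ≈ dom ∘ sq-k
    sq-dom = trans (sym (glue dom-comp)) (trans (∘-congʳ (pb.commute comp comp)) (glue dom-comp))

    cospan : Square ⇒ Cospan
    cospan = pb.universal cod cod sq-f sq-g sq-cod

    field
      square  : Cospan ⇒ Square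
      section : cospan ∘ square ≈ id

    leg₁ : Cospan ⇒ C₁
    leg₁ = sq-h ∘ square

    leg₂ : Cospan ⇒ C₁
    leg₂ = sq-k ∘ square

    apex : Cospan ⇒ C₀
    apex = dom ∘ leg₁

    apex≈ : apex ≈ dom ∘ leg₂
    apex≈ = glue sq-dom

    -- The mediating arrow of a square is the arrow from its corner into the
    -- apex of the chosen square on the same cospan.
    field
      med     : Square ⇒ C₁
      med-cod : cod ∘ med ≈ apex ∘ cospan

    med-cod₁ : cod ∘ med ≈ dom ∘ (leg₁ ∘ cospan)
    med-cod₁ = trans med-cod assoc

    med-cod₂ : cod ∘ med ≈ dom ∘ (leg₂ ∘ cospan)
    med-cod₂ = trans med-cod (trans (∘-congˡ apex≈) assoc)

    field
      med-leg₁ : med ⨾ (leg₁ ∘ cospan) [ med-cod₁ ] ≈ sq-h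
      med-leg₂ : med ⨾ (leg₂ ∘ cospan) [ med-cod₂ ] ≈ sq-k
      med-unique : ∀ {T} (s : T ⇒ Square) (m : T ⇒ C₁)
                   (c₁ : cod ∘ m ≈ dom ∘ (leg₁ ∘ (cospan ∘ s)))
                   (c₂ : cod ∘ m ≈ dom ∘ (leg₂ ∘ (cospan ∘ s))) →
                   m ⨾ (leg₁ ∘ (cospan ∘ s)) [ c₁ ] ≈ sq-h ∘ s →
                   m ⨾ (leg₂ ∘ (cospan ∘ s)) [ c₂ ] ≈ sq-k ∘ s →
                   m ≈ med ∘ s

module Global {𝓑 : Category o ℓ e} (L : ChosenFiniteLimits 𝓑) (ℂ : InternalCategory 𝓑) where
  open Category 𝓑
  open ChosenFiniteLimits L
  open InternalCategory ℂ

  GlobalObject : Set ℓ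
  GlobalObject = ⊤ ⇒ C₀

  private
    variable
      S T : Obj
      W X Y Z : GlobalObject

  Hom : GlobalObject → GlobalObject → Obj
  Hom X Y = Pb ⟨ dom , cod ⟩ ⟨ X , Y ⟩

  arr : T ⇒ Hom X Y → T ⇒ C₁
  arr {X = X} {Y} a = pb₁ ⟨ dom , cod ⟩ ⟨ X , Y ⟩ ∘ a

  private
    ⟨⟩-∘ : ∀ {A B} {h : T ⇒ A} {k : T ⇒ B} {t : S ⇒ T} {h′ : S ⇒ A} {k′ : S ⇒ B} →
           h ∘ t ≈ h′ → k ∘ t ≈ k′ → ⟨ h , k ⟩ ∘ t ≈ ⟨ h′ , k′ ⟩
    ⟨⟩-∘ r s = pb.unique ! !
      (trans (pullˡ fst∘⟨⟩) (trans r (sym fst∘⟨⟩)))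
      (trans (pullˡ snd∘⟨⟩) (trans s (sym snd∘⟨⟩)))

    hom-commute : (a : T ⇒ Hom X Y) → ⟨ dom , cod ⟩ ∘ arr a ≈ ⟨ X , Y ⟩ ∘ !
    hom-commute a = trans (glue (pb.commute _ _)) (∘-congʳ (!-unique _ _))

  dom-arr : (a : T ⇒ Hom X Y) → dom ∘ arr a ≈ X ∘ !
  dom-arr a = trans (sym (pullˡ fst∘⟨⟩))
    (trans (∘-congʳ (hom-commute a)) (pullˡ fst∘⟨⟩))

  cod-arr : (a : T ⇒ Hom X Y) → cod ∘ arr a ≈ Y ∘ !
  cod-arr a = trans (sym (pullˡ snd∘⟨⟩))
    (trans (∘-congʳ (hom-commute a)) (pullˡ snd∘⟨⟩))

  opaque
    fromArr : (m : T ⇒ C₁) → dom ∘ m ≈ X ∘ ! → cod ∘ m ≈ Y ∘ ! → T ⇒ Hom X Y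
    fromArr {X = X} {Y} m d c = pb.universal ⟨ dom , cod ⟩ ⟨ X , Y ⟩ m !
      (trans (⟨⟩-∘ d c) (sym (⟨⟩-∘ refl refl)))

    arr-fromArr : {m : T ⇒ C₁} {d : dom ∘ m ≈ X ∘ !} {c : cod ∘ m ≈ Y ∘ !} →
                  arr (fromArr m d c) ≈ m
    arr-fromArr = pb.p₁∘universal _ _

  arr-injective : {a b : T ⇒ Hom X Y} → arr a ≈ arr b → a ≈ b
  arr-injective p = pb.unique _ _ p (!-unique _ _)

  arr-∘ : {a : T ⇒ Hom X Y} {t : S ⇒ T} → arr (a ∘ t) ≈ arr a ∘ t
  arr-∘ = sym assoc

  !∘ : ∀ {A} {t : S ⇒ T} {x : ⊤ ⇒ A} → (x ∘ !) ∘ t ≈ x ∘ !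
  !∘ = trans assoc (∘-congʳ (!-unique _ _))

  opaque
    coerce : X ≈ W → Y ≈ Z → T ⇒ Hom X Y → T ⇒ Hom W Z
    coerce p q a = fromArr (arr a) (trans (dom-arr a) (∘-congˡ p)) (trans (cod-arr a) (∘-congˡ q))

    arr-coerce : {p : X ≈ W} {q : Y ≈ Z} {a : T ⇒ Hom X Y} → arr (coerce p q a) ≈ arr a
    arr-coerce = arr-fromArr

  opaque
    identity : T ⇒ Hom X X
    identity {X = X} = fromArr (ide ∘ (X ∘ !))
      (trans (pullˡ dom-ide) identityˡ) (trans (pullˡ cod-ide) identityˡ)

    arr-identity : arr (identity {T} {X}) ≈ ide ∘ (X ∘ !)
    arr-identity = arr-fromArr

  infixl 8 _∙_

  hom-composable : (a : T ⇒ Hom X Y) (b : T ⇒ Hom Y Z) → cod ∘ arr a ≈ dom ∘ arr b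
  hom-composable a b = trans (cod-arr a) (sym (dom-arr b))

  opaque
    _∙_ : T ⇒ Hom X Y → T ⇒ Hom Y Z → T ⇒ Hom X Z
    a ∙ b = fromArr (arr a ⨾ arr b [ hom-composable a b ])
      (trans dom-⨾ (dom-arr a)) (trans cod-⨾ (cod-arr b))

    arr-∙ : {a : T ⇒ Hom X Y} {b : T ⇒ Hom Y Z} →
            arr (a ∙ b) ≈ arr a ⨾ arr b [ hom-composable a b ]
    arr-∙ = arr-fromArr

  arr-cong : {a b : T ⇒ Hom X Y} → a ≈ b → arr a ≈ arr b
  arr-cong = ∘-congʳ

  compHom : Hom X Y × Hom Y Z ⇒ Hom X Z
  compHom = fst ∙ snd

  ∙-cong : {a a′ : T ⇒ Hom X Y} {b b′ : T ⇒ Hom Y Z} → a ≈ a′ → b ≈ b′ → a ∙ b ≈ a′ ∙ b′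
  ∙-cong p q = arr-injective (trans arr-∙
    (trans (⨾-cong (arr-cong p) (arr-cong q)) (sym arr-∙)))

  ∙-arr-cong : {a : T ⇒ Hom W Y} {a′ : T ⇒ Hom W Z} {b : T ⇒ Hom Y X} {b′ : T ⇒ Hom Z X} →
               arr a ≈ arr a′ → arr b ≈ arr b′ → a ∙ b ≈ a′ ∙ b′
  ∙-arr-cong p q = arr-injective (trans arr-∙ (trans (⨾-cong p q) (sym arr-∙)))

  ∙-∘ : {a : T ⇒ Hom X Y} {b : T ⇒ Hom Y Z} {t : S ⇒ T} → (a ∙ b) ∘ t ≈ (a ∘ t) ∙ (b ∘ t)
  ∙-∘ = arr-injective (trans arr-∘ (trans (∘-congˡ arr-∙)
    (trans (⨾-∘ (sym arr-∘) (sym arr-∘)) (sym arr-∙))))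

  ∙-identityˡ : {a : T ⇒ Hom X Y} → identity ∙ a ≈ a
  ∙-identityˡ = arr-injective (trans arr-∙ (⨾-idˡ arr-identity))

  ∙-identityʳ : {a : T ⇒ Hom X Y} → a ∙ identity ≈ a
  ∙-identityʳ = arr-injective (trans arr-∙ (⨾-idʳ arr-identity))

  ∙-assoc : {a : T ⇒ Hom W X} {b : T ⇒ Hom X Y} {c : T ⇒ Hom Y Z} →
            (a ∙ b) ∙ c ≈ a ∙ (b ∙ c)
  ∙-assoc {a = a} {b} {c} = arr-injective (trans arr-∙ (trans
    (⨾-cong {p′ = trans cod-⨾ (hom-composable b c)} arr-∙ refl)
    (trans (⨾-assoc _ (hom-composable b c) _ (trans (hom-composable a b) (sym dom-⨾)))
      (trans (⨾-cong refl (sym arr-∙)) (sym arr-∙)))))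

  slide : (a : T ⇒ Hom W X) (b : ⊤ ⇒ Hom X Y) (c : ⊤ ⇒ Hom Y Z) →
          (a ∙ (b ∘ !)) ∙ (c ∘ !) ≈ a ∙ ((b ∙ c) ∘ !)
  slide a b c = trans ∙-assoc (∙-cong refl (sym ∙-∘))

  identity-∘ : {t : S ⇒ T} → identity {X = X} ∘ t ≈ identity
  identity-∘ = arr-injective (trans arr-∘ (trans (∘-congˡ arr-identity)
    (trans assoc (trans (∘-congʳ !∘) (sym arr-identity)))))

  Γ : Category ℓ ℓ e
  Γ = record
    { Obj = GlobalObject
    ; _⇒_ = λ X Y → ⊤ ⇒ Hom X Y
    ; _≈_ = _≈_
    ; id = identity
    ; _∘_ = λ b a → a ∙ b
    ; equiv = equiv
    ; ∘-cong = λ p q → ∙-cong q p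
    ; identityˡ = ∙-identityʳ
    ; identityʳ = ∙-identityˡ
    ; assoc = sym ∙-assoc
    }

  module WithLimits (LC : InternalChosenFiniteLimits L ℂ) where
    open InternalChosenFiniteLimits LC

    module _ (f : ⊤ ⇒ Hom X Z) (g : ⊤ ⇒ Hom Y Z) where
      cospanΓ : ⊤ ⇒ Cospan
      cospanΓ = pb.universal cod cod (arr f) (arr g) (trans (cod-arr f) (sym (cod-arr g)))

      apexΓ : GlobalObject
      apexΓ = apex ∘ cospanΓ

      private
        x∘! : {x : ⊤ ⇒ C₀} → x ∘ ! ≈ x
        x∘! = trans (∘-congʳ (!-unique _ _)) identityʳ

        sq-f-square : sq-f ∘ square ≈ pb₁ cod cod
        sq-f-square = trans (∘-congˡ (sym (pb.p₁∘universal cod cod)))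
          (trans assoc (trans (∘-congʳ section) identityʳ))

        sq-g-square : sq-g ∘ square ≈ pb₂ cod cod
        sq-g-square = trans (∘-congˡ (sym (pb.p₂∘universal cod cod)))
          (trans assoc (trans (∘-congʳ section) identityʳ))

        fΓ : (sq-f ∘ square) ∘ cospanΓ ≈ arr f
        fΓ = trans (∘-congˡ sq-f-square) (pb.p₁∘universal cod cod)

        gΓ : (sq-g ∘ square) ∘ cospanΓ ≈ arr g
        gΓ = trans (∘-congˡ sq-g-square) (pb.p₂∘universal cod cod)

        leg₁-cod : cod ∘ leg₁ ≈ dom ∘ (sq-f ∘ square)
        leg₁-cod = glue (glue C₂.commute)

        leg₂-cod : cod ∘ leg₂ ≈ dom ∘ (sq-g ∘ square)
        leg₂-cod = glue (glue C₂.commute)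

      leg₁Γ : ⊤ ⇒ Hom apexΓ X
      leg₁Γ = fromArr (leg₁ ∘ cospanΓ) (trans (sym assoc) (sym x∘!))
        (trans (glue leg₁-cod) (trans (∘-congʳ fΓ) (dom-arr f)))

      leg₂Γ : ⊤ ⇒ Hom apexΓ Y
      leg₂Γ = fromArr (leg₂ ∘ cospanΓ)
        (trans (sym assoc) (trans (∘-congˡ (sym apex≈)) (sym x∘!)))
        (trans (glue leg₂-cod) (trans (∘-congʳ gΓ) (dom-arr g)))

      private
        sq-top : comp ∘ pb₁ comp comp ≈ sq-h ⨾ sq-f [ glue C₂.commute ]
        sq-top = ∘-congʳ (C₂.unique (sym C₂.p₁∘universal) (sym C₂.p₂∘universal))

        sq-bot : comp ∘ pb₂ comp comp ≈ sq-k ⨾ sq-g [ glue C₂.commute ]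
        sq-bot = ∘-congʳ (C₂.unique (sym C₂.p₁∘universal) (sym C₂.p₂∘universal))

        sq-eq : sq-h ⨾ sq-f [ glue C₂.commute ] ≈ sq-k ⨾ sq-g [ glue C₂.commute ]
        sq-eq = trans (sym sq-top) (trans (pb.commute comp comp) sq-bot)

      commuteΓ : leg₁Γ ∙ f ≈ leg₂Γ ∙ g
      commuteΓ = arr-injective (trans arr-∙ (trans
        (sym (⨾-∘ (trans (sym assoc) (sym arr-fromArr)) (trans (sym assoc) fΓ)))
        (trans (∘-congˡ sq-eq)
          (trans (⨾-∘ (trans (sym assoc) (sym arr-fromArr)) (trans (sym assoc) gΓ))
            (sym arr-∙)))))

      -- The chosen pullbacks are universal for generalized elements of
      -- hom-objects.  At T = ⊤ this gives the pullbacks of Γ, and at W = one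
      -- their preservation by γ.

      module _ (h : T ⇒ Hom W X) (k : T ⇒ Hom W Y) (r : h ∙ (f ∘ !) ≈ k ∙ (g ∘ !)) where
        private
          left right : T ⇒ C₂
          left  = C₂.universal (arr h) (arr (f ∘ !)) (hom-composable h (f ∘ !))
          right = C₂.universal (arr k) (arr (g ∘ !)) (hom-composable k (g ∘ !))

        toSquare : T ⇒ Square
        toSquare = pb.universal comp comp left right
          (trans (sym arr-∙) (trans (arr-cong r) arr-∙))

        sq-h-to : sq-h ∘ toSquare ≈ arr h
        sq-h-to = trans assoc (trans (∘-congʳ (pb.p₁∘universal comp comp)) C₂.p₁∘universal)

        sq-k-to : sq-k ∘ toSquare ≈ arr k
        sq-k-to = trans assoc (trans (∘-congʳ (pb.p₂∘universal comp comp)) C₂.p₁∘universal)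

        cospan-to : cospan ∘ toSquare ≈ cospanΓ ∘ !
        cospan-to = pb.unique cod cod
          (trans (pullˡ (pb.p₁∘universal cod cod)) (trans assoc
            (trans (∘-congʳ (pb.p₁∘universal comp comp)) (trans C₂.p₂∘universal
              (trans arr-∘ (sym (pullˡ (pb.p₁∘universal cod cod))))))))
          (trans (pullˡ (pb.p₂∘universal cod cod)) (trans assoc
            (trans (∘-congʳ (pb.p₂∘universal comp comp)) (trans C₂.p₂∘universal
              (trans arr-∘ (sym (pullˡ (pb.p₂∘universal cod cod))))))))

        leg₁-to : leg₁ ∘ (cospan ∘ toSquare) ≈ arr (leg₁Γ ∘ !)
        leg₁-to = trans (∘-congʳ cospan-to)
          (trans (sym assoc) (sym (trans arr-∘ (∘-congˡ arr-fromArr))))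

        leg₂-to : leg₂ ∘ (cospan ∘ toSquare) ≈ arr (leg₂Γ ∘ !)
        leg₂-to = trans (∘-congʳ cospan-to)
          (trans (sym assoc) (sym (trans arr-∘ (∘-congˡ arr-fromArr))))

        private
          med-eq₁ : (p : cod ∘ (med ∘ toSquare) ≈ dom ∘ arr (leg₁Γ ∘ !)) →
                    (med ∘ toSquare) ⨾ arr (leg₁Γ ∘ !) [ p ] ≈ arr h
          med-eq₁ p = trans (sym (⨾-∘ refl (trans assoc leg₁-to)))
            (trans (∘-congˡ med-leg₁) sq-h-to)

          med-eq₂ : (p : cod ∘ (med ∘ toSquare) ≈ dom ∘ arr (leg₂Γ ∘ !)) →
                    (med ∘ toSquare) ⨾ arr (leg₂Γ ∘ !) [ p ] ≈ arr k
          med-eq₂ p = trans (sym (⨾-∘ refl (trans assoc leg₂-to)))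
            (trans (∘-congˡ med-leg₂) sq-k-to)

          med-cod-to : cod ∘ (med ∘ toSquare) ≈ apexΓ ∘ !
          med-cod-to = trans (glue med-cod) (trans (∘-congʳ cospan-to) (sym assoc))

        mediate : T ⇒ Hom W apexΓ
        mediate = fromArr (med ∘ toSquare)
          (trans (sym dom-⨾) (trans (∘-congʳ (med-eq₁ (trans med-cod-to (sym (dom-arr _)))))
            (dom-arr h)))
          med-cod-to

        mediate₁ : mediate ∙ (leg₁Γ ∘ !) ≈ h
        mediate₁ = arr-injective (trans arr-∙ (trans
          (⨾-cong {p′ = trans med-cod-to (sym (dom-arr _))} arr-fromArr refl) (med-eq₁ _)))

        mediate₂ : mediate ∙ (leg₂Γ ∘ !) ≈ k
        mediate₂ = arr-injective (trans arr-∙ (trans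
          (⨾-cong {p′ = trans med-cod-to (sym (dom-arr _))} arr-fromArr refl) (med-eq₂ _)))

        mediate-unique : (m : T ⇒ Hom W apexΓ) → m ∙ (leg₁Γ ∘ !) ≈ h → m ∙ (leg₂Γ ∘ !) ≈ k →
                         m ≈ mediate
        mediate-unique m p q = arr-injective (trans
          (med-unique toSquare (arr m)
            (trans (hom-composable m (leg₁Γ ∘ !)) (∘-congʳ (sym leg₁-to)))
            (trans (hom-composable m (leg₂Γ ∘ !)) (∘-congʳ (sym leg₂-to)))
            (trans (⨾-cong refl leg₁-to) (trans (sym arr-∙)
              (trans (arr-cong p) (sym sq-h-to))))
            (trans (⨾-cong refl leg₂-to) (trans (sym arr-∙)
              (trans (arr-cong q) (sym sq-k-to)))))
          (sym arr-fromArr))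

      mediate-mono : {m n : T ⇒ Hom W apexΓ} → m ∙ (leg₁Γ ∘ !) ≈ n ∙ (leg₁Γ ∘ !) →
                     m ∙ (leg₂Γ ∘ !) ≈ n ∙ (leg₂Γ ∘ !) → m ≈ n
      mediate-mono {m = m} {n} p q =
        trans (mediate-unique _ _ r m p q) (sym (mediate-unique _ _ r n refl refl))
        where
          r : (n ∙ (leg₁Γ ∘ !)) ∙ (f ∘ !) ≈ (n ∙ (leg₂Γ ∘ !)) ∙ (g ∘ !)
          r = trans (slide n leg₁Γ f)
                (trans (∙-cong refl (∘-congˡ commuteΓ)) (sym (slide n leg₂Γ g)))

    private
      ∘! : {x : ⊤ ⇒ S} → x ∘ ! ≈ x
      ∘! = trans (∘-congʳ (!-unique _ _)) identityʳ

    toOne : T ⇒ Hom X one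
    toOne {X = X} = fromArr (bang ∘ (X ∘ !)) (trans (pullˡ dom-bang) identityˡ)
      (trans (glue cod-bang) (∘-congʳ (!-unique _ _)))

    toOne-unique : (a b : T ⇒ Hom X one) → a ≈ b
    toOne-unique a b = arr-injective (trans (bang-unique _ (cod-arr a))
      (trans (∘-congʳ (trans (dom-arr a) (sym (dom-arr b)))) (sym (bang-unique _ (cod-arr b)))))

    Γ-limits : ChosenFiniteLimits Γ
    Γ-limits = record
      { ⊤ = one
      ; isTerminal = record { ! = toOne ; !-unique = toOne-unique }
      ; Pb = apexΓ
      ; pb₁ = leg₁Γ
      ; pb₂ = leg₂Γ
      ; isPullback = λ f g → record
        { commute = commuteΓ f g
        ; universal = λ h k r → mediate f g h k (glob r)
        ; p₁∘universal = λ {_} {h} {k} {r} →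
            trans (∙-cong refl (sym ∘!)) (mediate₁ f g h k (glob r))
        ; p₂∘universal = λ {_} {h} {k} {r} →
            trans (∙-cong refl (sym ∘!)) (mediate₂ f g h k (glob r))
        ; unique = λ p q → mediate-mono f g (glob p) (glob q)
        }
      }
      where
        glob : {h : ⊤ ⇒ Hom W X} {k : ⊤ ⇒ Hom W Y} {f : ⊤ ⇒ Hom X Z} {g : ⊤ ⇒ Hom Y Z} →
               h ∙ f ≈ k ∙ g → h ∙ (f ∘ !) ≈ k ∙ (g ∘ !)
        glob r = trans (∙-cong refl ∘!) (trans r (∙-cong refl (sym ∘!)))

    private
      postcompose : (f : ⊤ ⇒ Hom X Y) → Hom W X ⇒ Hom W Y
      postcompose f = compHom ∘ ⟨ id , f ∘ ! ⟩

      postcompose≈ : (f : ⊤ ⇒ Hom X Y) → postcompose {W = W} f ≈ id ∙ (f ∘ !)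
      postcompose≈ f = trans ∙-∘ (∙-cong fst∘⟨⟩ snd∘⟨⟩)

      postcompose-∘ : {a : T ⇒ Hom W X} (f : ⊤ ⇒ Hom X Y) → postcompose f ∘ a ≈ a ∙ (f ∘ !)
      postcompose-∘ f = trans (∘-congˡ (postcompose≈ f)) (trans ∙-∘ (∙-cong identityˡ !∘))

    γ : Functor Γ 𝓑
    γ = record
      { F₀ = λ X → Hom one X
      ; F₁ = postcompose
      ; F-cong = λ p → trans (postcompose≈ _)
          (trans (∙-cong refl (∘-congˡ p)) (sym (postcompose≈ _)))
      ; F-id = trans (postcompose≈ _) (trans (∙-cong refl identity-∘) ∙-identityʳ)
      ; F-∘ = λ {_} {_} {_} {f} {g} → trans (postcompose≈ _) (trans (∙-cong refl ∙-∘)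
          (trans (sym ∙-assoc)
            (trans (∙-cong (sym (postcompose≈ f)) refl) (sym (postcompose-∘ g)))))
      }

    γ-∘ : {a : T ⇒ Hom one X} (f : ⊤ ⇒ Hom X Y) → Functor.F₁ γ f ∘ a ≈ a ∙ (f ∘ !)
    γ-∘ = postcompose-∘

    opaque
      γ-preserves : PreservesFiniteLimits γ
      γ-preserves = preservesFromChosen Γ-limits γ
        (record { ! = toOne ; !-unique = toOne-unique })
        λ f g → record
          { commute = Functor.F-square γ (commuteΓ f g)
          ; universal = λ h k r → mediate f g h k (trans (sym (γ-∘ f)) (trans r (γ-∘ g)))
          ; p₁∘universal = trans (γ-∘ _) (mediate₁ f g _ _ _)
          ; p₂∘universal = trans (γ-∘ _) (mediate₂ f g _ _ _)
          ; unique = λ p q → mediate-mono f g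
              (trans (sym (γ-∘ _)) (trans p (γ-∘ _))) (trans (sym (γ-∘ _)) (trans q (γ-∘ _)))
          }

    -- Objects of Γ are morphisms of 𝓑, and morphisms of Γ are compared through
    -- their underlying global elements of C₁, so strictness is a family of
    -- equations in 𝓑.

    record StrictlyPreservesFiniteLimits {𝓐 : Category o′ ℓ′ e′} (LA : ChosenFiniteLimits 𝓐)
           (F : Functor 𝓐 Γ) : Set (o′ ⊔ ℓ′ ⊔ e) where
      private
        module A = Category 𝓐
        module LA = ChosenFiniteLimits LA
      open Functor F
      field
        strict-⊤   : F₀ LA.⊤ ≈ one
        strict-Pb  : ∀ {A B C} (f : A A.⇒ C) (g : B A.⇒ C) → F₀ (LA.Pb f g) ≈ apexΓ (F₁ f) (F₁ g)
        strict-pb₁ : ∀ {A B C} (f : A A.⇒ C) (g : B A.⇒ C) →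
                     arr (F₁ (LA.pb₁ f g)) ≈ arr (leg₁Γ (F₁ f) (F₁ g))
        strict-pb₂ : ∀ {A B C} (f : A A.⇒ C) (g : B A.⇒ C) →
                     arr (F₁ (LA.pb₂ f g)) ≈ arr (leg₂Γ (F₁ f) (F₁ g))

      opaque
        preserves : PreservesFiniteLimits F
        preserves = preservesFromChosen LA F
          (record
            { ! = coerce refl (sym strict-⊤) toOne
            ; !-unique = λ a b → arr-injective (trans (sym arr-coerce) (trans
                (arr-cong (toOne-unique (coerce refl strict-⊤ a) (coerce refl strict-⊤ b)))
                arr-coerce))
            })
          λ f g → transport f g
          where
            transport : ∀ {A B C} (f : A A.⇒ C) (g : B A.⇒ C) →
                        IsPullback Γ (F₁ (LA.pb₁ f g)) (F₁ (LA.pb₂ f g)) (F₁ f) (F₁ g)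
            transport f g = record
              { commute = F-square (LA.pb.commute f g)
              ; universal = λ h k r → coerce refl (sym P≈) (Q.universal h k r)
              ; p₁∘universal = trans (∙-arr-cong arr-coerce (strict-pb₁ f g)) Q.p₁∘universal
              ; p₂∘universal = trans (∙-arr-cong arr-coerce (strict-pb₂ f g)) Q.p₂∘universal
              ; unique = λ p q → arr-injective (trans (sym arr-coerce) (trans
                  (arr-cong (Q.unique
                    (trans (to₁ _) (trans p (sym (to₁ _))))
                    (trans (to₂ _) (trans q (sym (to₂ _))))))
                  arr-coerce))
              }
              where
                module Q = ChosenFiniteLimits.pb Γ-limits (F₁ f) (F₁ g)
                P≈ : F₀ (LA.Pb f g) ≈ apexΓ (F₁ f) (F₁ g)
                P≈ = strict-Pb f g
                to₁ : (x : ⊤ ⇒ Hom W (F₀ (LA.Pb f g))) →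
                      coerce refl P≈ x ∙ leg₁Γ (F₁ f) (F₁ g) ≈ x ∙ F₁ (LA.pb₁ f g)
                to₁ x = ∙-arr-cong arr-coerce (sym (strict-pb₁ f g))
                to₂ : (x : ⊤ ⇒ Hom W (F₀ (LA.Pb f g))) →
                      coerce refl P≈ x ∙ leg₂Γ (F₁ f) (F₁ g) ≈ x ∙ F₁ (LA.pb₂ f g)
                to₂ x = ∙-arr-cong arr-coerce (sym (strict-pb₂ f g))

record PreGeminal (o ℓ e : Level) : Set (suc (o ⊔ ℓ ⊔ e)) where
  field
    𝓑        : Category o ℓ e
    𝓑-limits : ChosenFiniteLimits 𝓑
    ℂ        : InternalCategory 𝓑
    ℂ-limits : InternalChosenFiniteLimits 𝓑-limits ℂ

  open Category 𝓑 public using (Obj; _⇒_; _≈_; _∘_)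
  open ChosenFiniteLimits 𝓑-limits public using (⊤)
  open InternalCategory ℂ public using (C₀; C₁)
  open InternalChosenFiniteLimits ℂ-limits public using (one)
  open Global 𝓑-limits ℂ public using (Γ; Hom; arr; coerce; module WithLimits)
  open WithLimits ℂ-limits public using (γ; γ-preserves; StrictlyPreservesFiniteLimits)

  field
    F        : Functor 𝓑 Γ
    F-strict : StrictlyPreservesFiniteLimits 𝓑-limits F

  open Functor F public using (F₀; F₁)

  □ : Functor 𝓑 𝓑
  □ = γ ∘F F

  open Functor □ public using () renaming (F₀ to □₀; F₁ to □₁)

  □-preserves : PreservesFiniteLimits □
  □-preserves = ∘F-preserves γ-preserves (StrictlyPreservesFiniteLimits.preserves F-strict)

  □ℂ : InternalCategory 𝓑
  □ℂ = image 𝓑-limits □ □-preserves ℂ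

  u : ⊤ ⇒ □₀ ⊤
  u = IsTerminal.! (PreservesFiniteLimits.preserves-⊤ □-preserves
        (ChosenFiniteLimits.isTerminal 𝓑-limits))

  field
    ℍ : InternalFunctor ℂ □ℂ

  open InternalFunctor ℍ public using () renaming (H₀ to ℍ₀; H₁ to ℍ₁)

  -- Γℍ ∘ F = F#_ℂ ∘ F, with global elements of F|ℂ| and F|ℂ→| in Γ, that is,
  -- morphisms F ⊤ → F C₀ and F ⊤ → F C₁, read as global elements of □ C₀ and
  -- □ C₁ along u.
  field
    ℍ-F₀ : ∀ A → ℍ₀ ∘ F₀ A ≈ □₁ (F₀ A) ∘ u
    ℍ-F₁ : ∀ {A B} (f : A ⇒ B) → ℍ₁ ∘ arr (F₁ f) ≈ □₁ (arr (F₁ f)) ∘ u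

  -- F a is a global element of Hom (F₀ ⊤) (F₀ A); the domain is replaced along
  -- F₀ ⊤ ≈ one.
  ⌜_⌝ : ∀ {A} → ⊤ ⇒ A → ⊤ ⇒ □₀ A
  ⌜ a ⌝ = coerce (StrictlyPreservesFiniteLimits.strict-⊤ F-strict) (Category.refl 𝓑) (F₁ a)

{-# OPTIONS --safe #-}

-- A diagonal argument carried out twice, first for objects and then for
-- arrows, with ℍ₁ sending a code m to its quotation 1 → F C₁.
--
-- Objects: an arrow n : Y → F C₁ of ℂ is a family, and δ n is its fibre over
-- the quotation of n.  Let R be the object of pairs (n , m) with m : δ n → F A,
-- let r : R → C₁ be the first projection, let ρ be the code of F r, and let S
-- be the fibre of r over ρ.  Since F preserves pullbacks strictly, F S is δ ρ,
-- so S is isomorphic to Hom (F S) (F A).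
--
-- Arrows: precomposing m : F S → F A with the quotation of the element of S
-- corresponding to m gives d m in □ A.  Let g : S → A correspond to f ∘ d, and
-- let a be g at the element of S corresponding to F g; then d (F g) = F a.

module Submission where

open import Defs
open import Level using (Level; _⊔_)
open import Data.Product using (∃-syntax; _,_)

module _ {o ℓ e : Level} (𝓖 : PreGeminal o ℓ e) where
  open PreGeminal 𝓖
  open Category 𝓑 hiding (Obj; _⇒_; _≈_; _∘_)
  open ChosenFiniteLimits 𝓑-limits hiding (⊤)
  open InternalCategory ℂ using (dom; cod)
  open InternalChosenFiniteLimits ℂ-limits using (Cospan; apex)
  open Global 𝓑-limits ℂ hiding (Γ; Hom; arr; coerce; module WithLimits)
  open WithLimits ℂ-limits using (γ-∘)
  open StrictlyPreservesFiniteLimits F-strict using (strict-⊤; strict-Pb)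
  open Functor □ using (F-triangle)
  open InternalFunctor ℍ using (H-dom; H-cod)
  open PreservesFiniteLimits □-preserves
  open ≈-Reasoning

  private
    variable
      A B X : Obj

  global∘! : {x : ⊤ ⇒ X} → x ∘ ! ≈ x
  global∘! = trans (∘-congʳ (!-unique _ _)) identityʳ

  -- `□₀ ⊤` is terminal, so its global element may be taken to be an identity, which makes `u` a
  -- left unit for `∙` up to `coerce`.
  u≈identity : u ≈ coerce refl (sym strict-⊤) identity
  u≈identity = IsTerminal.!-unique (preserves-⊤ isTerminal) _ _

  arr-⌜⌝ : {a : ⊤ ⇒ A} → arr ⌜ a ⌝ ≈ arr (F₁ a)
  arr-⌜⌝ = arr-coerce

  □₁∘u≈⌜⌝ : {a : ⊤ ⇒ A} → □₁ a ∘ u ≈ ⌜ a ⌝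
  □₁∘u≈⌜⌝ {a = a} = begin
    □₁ a ∘ u             ≈⟨ γ-∘ (F₁ a) ⟩
    u ∙ (F₁ a ∘ !)       ≈⟨ ∙-arr-cong
                              (trans (arr-cong u≈identity) arr-coerce)
                              (trans (arr-cong global∘!) (sym arr-⌜⌝)) ⟩
    identity ∙ ⌜ a ⌝     ≈⟨ ∙-identityˡ ⟩
    ⌜ a ⌝                ∎

  -- The axiom on `ℍ₁`, read inside `C₁`: the code `arr (F₁ f)` goes to its own image under `F`.
  arr-ℍ₁-quote : (f : A ⇒ B) → arr (ℍ₁ ∘ arr (F₁ f)) ≈ arr (F₁ (arr (F₁ f)))
  arr-ℍ₁-quote f = trans (arr-cong (trans (ℍ-F₁ f) □₁∘u≈⌜⌝)) arr-⌜⌝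

  module _ {A B : Obj} where
    private
      K : Obj
      K = Hom (F₀ A) (F₀ B)
      ends : C₁ ⇒ C₀ × C₀
      ends = ⟨ dom , cod ⟩
      corners : ⊤ ⇒ C₀ × C₀
      corners = ⟨ F₀ A , F₀ B ⟩
      module □K = IsPullback (preserves-pb (isPullback ends corners))
      module □× = IsPullback (preserves-pb (isPullback (! {C₀}) (! {C₀})))

      -- `arr id` is the universal arrow indexed by `K`; `ℍ-F₀` quotes its endpoints, and `□`
      -- preserves the product, so the two projections suffice.
      ℍ₁-ends : □₁ ends ∘ (ℍ₁ ∘ arr id) ≈ □₁ corners ∘ (u ∘ !)
      ℍ₁-ends = □×.unique
        (begin
          □₁ fst ∘ (□₁ ends ∘ (ℍ₁ ∘ arr id))  ≈⟨ pullˡ (F-triangle fst∘⟨⟩) ⟩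
          □₁ dom ∘ (ℍ₁ ∘ arr id)              ≈⟨ glue H-dom ⟩
          ℍ₀ ∘ (dom ∘ arr id)                 ≈⟨ ∘-congʳ (dom-arr id) ⟩
          ℍ₀ ∘ (F₀ A ∘ !)                     ≈⟨ glue (ℍ-F₀ A) ⟩
          □₁ (F₀ A) ∘ (u ∘ !)                 ≈⟨ pullˡ (F-triangle fst∘⟨⟩) ⟨
          □₁ fst ∘ (□₁ corners ∘ (u ∘ !))     ∎)
        (begin
          □₁ snd ∘ (□₁ ends ∘ (ℍ₁ ∘ arr id))  ≈⟨ pullˡ (F-triangle snd∘⟨⟩) ⟩
          □₁ cod ∘ (ℍ₁ ∘ arr id)              ≈⟨ glue H-cod ⟩
          ℍ₀ ∘ (cod ∘ arr id)                 ≈⟨ ∘-congʳ (cod-arr id) ⟩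
          ℍ₀ ∘ (F₀ B ∘ !)                     ≈⟨ glue (ℍ-F₀ B) ⟩
          □₁ (F₀ B) ∘ (u ∘ !)                 ≈⟨ pullˡ (F-triangle snd∘⟨⟩) ⟨
          □₁ snd ∘ (□₁ corners ∘ (u ∘ !))     ∎)

    -- `□` preserves the pullback defining the hom-object, so `ℍ₁` restricts to it.
    quoteHom : Hom (F₀ A) (F₀ B) ⇒ □₀ (Hom (F₀ A) (F₀ B))
    quoteHom = □K.universal (ℍ₁ ∘ arr id) (u ∘ !) ℍ₁-ends

    quoteHom-F₁ : (f : A ⇒ B) → quoteHom ∘ F₁ f ≈ □₁ (F₁ f) ∘ u
    quoteHom-F₁ f = □K.unique
      (begin
        □₁ (pb₁ ends corners) ∘ (quoteHom ∘ F₁ f)  ≈⟨ pullˡ □K.p₁∘universal ⟩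
        (ℍ₁ ∘ arr id) ∘ F₁ f                       ≈⟨ assoc ⟩
        ℍ₁ ∘ (arr id ∘ F₁ f)                       ≈⟨ ∘-congʳ (∘-congˡ identityʳ) ⟩
        ℍ₁ ∘ arr (F₁ f)                            ≈⟨ ℍ-F₁ f ⟩
        □₁ (arr (F₁ f)) ∘ u                        ≈⟨ pullˡ (F-triangle refl) ⟨
        □₁ (pb₁ ends corners) ∘ (□₁ (F₁ f) ∘ u)    ∎)
      (begin
        □₁ (pb₂ ends corners) ∘ (quoteHom ∘ F₁ f)  ≈⟨ pullˡ □K.p₂∘universal ⟩
        (u ∘ !) ∘ F₁ f                             ≈⟨ assoc ⟩
        u ∘ (! ∘ F₁ f)                             ≈⟨ IsTerminal.!-unique (preserves-⊤ isTerminal) _ _ ⟩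
        □₁ (pb₂ ends corners) ∘ (□₁ (F₁ f) ∘ u)    ∎)

  -- The retraction lets every morphism out of the hom-object extend along `encode` to `S`, as in
  -- Lawvere's fixed-point argument.
  record ArrowCodes (A : Obj) : Set (o ⊔ ℓ ⊔ e) where
    field
      S             : Obj
      decode        : S ⇒ Hom (F₀ S) (F₀ A)
      encode        : Hom (F₀ S) (F₀ A) ⇒ S
      decode∘encode : decode ∘ encode ≈ id

  module _ (A : Obj) where
    private
      Family : Obj
      Family = Pb cod (F₀ C₁)

      family : Family ⇒ C₁
      family = pb₁ cod (F₀ C₁)

      cod-family : cod ∘ family ≈ F₀ C₁ ∘ !
      cod-family = trans (pb.commute cod (F₀ C₁)) (∘-congʳ (!-unique _ _))

      -- The legs are n and its quotation: `ℍ₁ ∘ family` lands in `□₀ C₁`, whose elements are arrows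
      -- from `one` to `F₀ C₁`.
      selfCospan : Family ⇒ Cospan
      selfCospan = pb.universal cod cod family (arr (ℍ₁ ∘ family))
        (trans cod-family (sym (cod-arr (ℍ₁ ∘ family))))

      δ : Family ⇒ C₀
      δ = apex ∘ selfCospan

      Into : Obj
      Into = Pb cod (F₀ A)

      into : Into ⇒ C₁
      into = pb₁ cod (F₀ A)

      cod-into : cod ∘ into ≈ F₀ A ∘ !
      cod-into = trans (pb.commute cod (F₀ A)) (∘-congʳ (!-unique _ _))

      R : Obj
      R = Pb δ (dom ∘ into)

      module R = IsPullback (isPullback δ (dom ∘ into))

      R-family : R ⇒ Family
      R-family = pb₁ δ (dom ∘ into)

      R-into : R ⇒ Into
      R-into = pb₂ δ (dom ∘ into)

      r : R ⇒ C₁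
      r = family ∘ R-family

      -- Self-reference enters here: `r` takes values in `C₁`, so `F₁ r` ends at `F₀ C₁` and is
      -- itself a family.
      ρ : ⊤ ⇒ C₁
      ρ = arr (F₁ r)

      cod-ρ : cod ∘ ρ ≈ F₀ C₁ ∘ id
      cod-ρ = trans (cod-arr (F₁ r)) (∘-congʳ (!-unique _ _))

      ρ-family : ⊤ ⇒ Family
      ρ-family = pb.universal cod (F₀ C₁) ρ id cod-ρ

      family∘ρ-family : family ∘ ρ-family ≈ ρ
      family∘ρ-family = pb.p₁∘universal cod (F₀ C₁)

      S : Obj
      S = Pb r ρ

      -- Both sides are chosen apexes over the same cospan. An equality of global objects, not
      -- merely an isomorphism, is what the domain conditions in `dom-S` and `K-R` ask for.
      F₀S≈δρ : F₀ S ≈ δ ∘ ρ-family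
      F₀S≈δρ = trans (strict-Pb r ρ) (trans (∘-congʳ (pb.unique cod cod
        (trans (pb.p₁∘universal cod cod)
          (sym (trans (pullˡ (pb.p₁∘universal cod cod)) family∘ρ-family)))
        (begin
          pb₂ cod cod ∘ _                       ≈⟨ pb.p₂∘universal cod cod ⟩
          -- Strictness gives the leg `F₁ ρ`, while `δ` uses the quotation of `ρ`; they agree
          -- because `ρ` is the code of `F₁ r`.
          arr (F₁ ρ)                            ≈⟨ arr-ℍ₁-quote r ⟨
          arr (ℍ₁ ∘ ρ)                          ≈⟨ arr-cong (∘-congʳ family∘ρ-family) ⟨
          arr (ℍ₁ ∘ (family ∘ ρ-family))        ≈⟨ arr-cong assoc ⟨
          arr ((ℍ₁ ∘ family) ∘ ρ-family)        ≈⟨ arr-∘ ⟩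
          arr (ℍ₁ ∘ family) ∘ ρ-family          ≈⟨ pullˡ (pb.p₂∘universal cod cod) ⟨
          pb₂ cod cod ∘ (selfCospan ∘ ρ-family) ∎)))
        (sym assoc))

      S-into : S ⇒ Into
      S-into = R-into ∘ pb₁ r ρ

      S-family : R-family ∘ pb₁ r ρ ≈ ρ-family ∘ !
      S-family = pb.unique cod (F₀ C₁)
        (trans (sym assoc) (trans (pb.commute r ρ) (trans (∘-congʳ (!-unique _ _))
          (sym (pullˡ family∘ρ-family)))))
        (!-unique _ _)

      -- Over `S` the family is constantly `ρ`, so m starts at its fibre `δ ∘ ρ-family`.
      dom-S : dom ∘ (into ∘ S-into) ≈ F₀ S ∘ !
      dom-S = begin
        dom ∘ (into ∘ S-into)            ≈⟨ assoc ⟨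
        (dom ∘ into) ∘ S-into            ≈⟨ glue R.commute ⟨
        δ ∘ (R-family ∘ pb₁ r ρ)         ≈⟨ ∘-congʳ S-family ⟩
        δ ∘ (ρ-family ∘ !)               ≈⟨ pullˡ (sym F₀S≈δρ) ⟩
        F₀ S ∘ !                         ∎

      decode : S ⇒ Hom (F₀ S) (F₀ A)
      decode = fromArr (into ∘ S-into) dom-S
        (trans (pullˡ cod-into) !∘)

      K : Obj
      K = Hom (F₀ S) (F₀ A)

      K-into : K ⇒ Into
      K-into = pb.universal cod (F₀ A) (arr id) ! (cod-arr id)

      into∘K-into : into ∘ K-into ≈ arr id
      into∘K-into = pb.p₁∘universal cod (F₀ A)

      -- Each m is paired with the constant family `ρ`, whose fibre is the domain of m.
      K-R : K ⇒ R
      K-R = R.universal (ρ-family ∘ !) K-into (begin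
        δ ∘ (ρ-family ∘ !)       ≈⟨ pullˡ (sym F₀S≈δρ) ⟩
        F₀ S ∘ !                 ≈⟨ dom-arr id ⟨
        dom ∘ arr id             ≈⟨ ∘-congʳ into∘K-into ⟨
        dom ∘ (into ∘ K-into)    ≈⟨ assoc ⟨
        (dom ∘ into) ∘ K-into    ∎)

      encode : K ⇒ S
      encode = pb.universal r ρ K-R !
        (trans assoc (trans (∘-congʳ R.p₁∘universal) (pullˡ family∘ρ-family)))

      decode∘encode : decode ∘ encode ≈ id
      decode∘encode = arr-injective (begin
        arr (decode ∘ encode)               ≈⟨ arr-∘ ⟩
        arr decode ∘ encode                 ≈⟨ ∘-congˡ arr-fromArr ⟩
        (into ∘ S-into) ∘ encode            ≈⟨ assoc ⟩
        into ∘ (S-into ∘ encode)            ≈⟨ ∘-congʳ assoc ⟩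
        into ∘ (R-into ∘ (pb₁ r ρ ∘ encode)) ≈⟨ ∘-congʳ (∘-congʳ (pb.p₁∘universal r ρ)) ⟩
        into ∘ (R-into ∘ K-R)               ≈⟨ ∘-congʳ R.p₂∘universal ⟩
        into ∘ K-into                       ≈⟨ into∘K-into ⟩
        arr id                              ∎)

    arrowCodes : ArrowCodes A
    arrowCodes = record
      { S = S ; decode = decode ; encode = encode ; decode∘encode = decode∘encode }

  module _ (codes : ArrowCodes A) where
    open ArrowCodes codes

    -- This is the map d; `id` stands for the generic arrow m.
    selfApply : Hom (F₀ S) (F₀ A) ⇒ □₀ A
    selfApply = (□₁ encode ∘ quoteHom) ∙ id

    -- At a code `F₁ g`, composing with m is the action of `□₁ g`, so functoriality of `□` merges it
    -- with the quoted point `encode ∘ F₁ g`.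
    selfApply-F₁ : (g : S ⇒ A) → selfApply ∘ F₁ g ≈ ⌜ g ∘ (encode ∘ F₁ g) ⌝
    selfApply-F₁ g = begin
      selfApply ∘ F₁ g                              ≈⟨ ∙-∘ ⟩
      ((□₁ encode ∘ quoteHom) ∘ F₁ g) ∙ (id ∘ F₁ g) ≈⟨ ∙-cong quoted (trans identityˡ (sym global∘!)) ⟩
      (□₁ (encode ∘ F₁ g) ∘ u) ∙ (F₁ g ∘ !)         ≈⟨ γ-∘ (F₁ g) ⟨
      □₁ g ∘ (□₁ (encode ∘ F₁ g) ∘ u)               ≈⟨ pullˡ (F-triangle refl) ⟩
      □₁ (g ∘ (encode ∘ F₁ g)) ∘ u                  ≈⟨ □₁∘u≈⌜⌝ ⟩
      ⌜ g ∘ (encode ∘ F₁ g) ⌝                       ∎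
      where
        quoted : (□₁ encode ∘ quoteHom) ∘ F₁ g ≈ □₁ (encode ∘ F₁ g) ∘ u
        quoted = trans assoc (trans (∘-congʳ (quoteHom-F₁ g)) (pullˡ (F-triangle refl)))

    fixedPoint : (f : □₀ A ⇒ A) → ∃[ a ] f ∘ ⌜ a ⌝ ≈ a
    fixedPoint f = g ∘ (encode ∘ F₁ g) , (begin
      f ∘ ⌜ g ∘ (encode ∘ F₁ g) ⌝                     ≈⟨ ∘-congʳ (selfApply-F₁ g) ⟨
      f ∘ (selfApply ∘ F₁ g)                          ≈⟨ assoc ⟨
      (f ∘ selfApply) ∘ F₁ g                          ≈⟨ ∘-congʳ identityˡ ⟨
      -- Inserting the retraction turns `f ∘ selfApply` into `g`, evaluated at the element of `S`
      -- that encodes `F₁ g`.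
      (f ∘ selfApply) ∘ (id ∘ F₁ g)                   ≈⟨ ∘-congʳ (pullˡ decode∘encode) ⟨
      (f ∘ selfApply) ∘ (decode ∘ (encode ∘ F₁ g))    ≈⟨ assoc ⟨
      g ∘ (encode ∘ F₁ g)                             ∎)
      where
        g : S ⇒ A
        g = (f ∘ selfApply) ∘ decode

theorem5p4 : ∀ {o ℓ e : Level} (𝓖 : PreGeminal o ℓ e) → let open PreGeminal 𝓖 in
    ∀ {A : Obj} (f : □₀ A ⇒ A) → ∃[ a ] f ∘ ⌜ a ⌝ ≈ a
theorem5p4 𝓖 {A} = fixedPoint 𝓖 (arrowCodes 𝓖 A)
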